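{- For all positive integers $m$ and $n$ with $2 \le m \le n$, $\gamma^{\rm ID}(P_m \Box P_n) \ge mn/3$.
   Context: $P_n$ is the path on $n$ vertices and $\Box$ denotes the Cartesian product of graphs. $N[x]$ denotes the closed neighborhood of a vertex $x$. An identifying code (ID code) of a graph $F$ is a set $C\subseteq V(F)$ such that $N[x]\cap C\neq\emptyset$ for every vertex $x$ and $N[x]\cap C\neq N[y]\cap C$ for all distinct vertices $x,y$; $\gamma^{\rm ID}(F)$ is the minimum cardinality of an ID code of $F$. -}

module Defs where

open import Data.Fin.Base using (Fin; toℕ; remQuot)
open import Data.Fin.Properties using (_≟_)
open import Data.Fin.Subset using (Subset; Nonempty; _∩_; ∣_∣)
open import Data.Nat.Base using (ℕ; suc; _*_; _≤_)
import Data.Nat.Properties as ℕ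
open import Data.Product.Base using (_×_; _,_; ∃-syntax)
open import Data.Sum.Base using (_⊎_; inj₁; inj₂; swap)
open import Data.Vec.Base using (tabulate)
open import Function.Base using (_on_)
open import Level using (0ℓ)
open import Relation.Binary.Core using (Rel)
open import Relation.Binary.Definitions using (Decidable; Symmetric; Irreflexive)
open import Relation.Binary.PropositionalEquality using (_≡_; _≢_; refl; sym)
open import Relation.Nullary.Decidable using (does; _×-dec_; _⊎-dec_)

private
  variable
    m n : ℕ

record Graph (n : ℕ) : Set₁ where
  field
    Adj        : Rel (Fin n) 0ℓ
    adj?       : Decidable Adj
    adj-sym    : Symmetric Adj
    adj-irrefl : Irreflexive _≡_ Adj

open Graph

P : (n : ℕ) → Graph n
P n .Adj i j = suc (toℕ i) ≡ toℕ j ⊎ suc (toℕ j) ≡ toℕ i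
P n .adj? i j = (suc (toℕ i) ℕ.≟ toℕ j) ⊎-dec (suc (toℕ j) ℕ.≟ toℕ i)
P n .adj-sym = swap
P n .adj-irrefl refl (inj₁ e) = ℕ.1+n≢n e
P n .adj-irrefl refl (inj₂ e) = ℕ.1+n≢n e

BoxAdj : Graph m → Graph n → Rel (Fin m × Fin n) 0ℓ
BoxAdj G H (u , v) (u′ , v′) = (u ≡ u′ × Adj H v v′) ⊎ (Adj G u u′ × v ≡ v′)

boxAdj? : (G : Graph m) (H : Graph n) → Decidable (BoxAdj G H)
boxAdj? G H (u , v) (u′ , v′) =
  ((u ≟ u′) ×-dec adj? H v v′) ⊎-dec (adj? G u u′ ×-dec (v ≟ v′))

-- The Cartesian product, with the vertex pair (u , v) encoded as the element
-- combine u v of Fin (m * n), the bijection whose inverse is remQuot n.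
infixl 7 _□_
_□_ : Graph m → Graph n → Graph (m * n)
_□_ {m} {n} G H = record
  { Adj        = BoxAdj G H on remQuot {m} n
  ; adj?       = λ x y → boxAdj? G H (remQuot {m} n x) (remQuot {m} n y)
  ; adj-sym    = λ where
      (inj₁ (e , a)) → inj₁ (sym e , adj-sym H a)
      (inj₂ (a , e)) → inj₂ (adj-sym G a , sym e)
  ; adj-irrefl = λ where
      refl (inj₁ (_ , a)) → adj-irrefl H refl a
      refl (inj₂ (a , _)) → adj-irrefl G refl a
  }

module _ (G : Graph n) where

  N[_] : Fin n → Subset n
  N[ x ] = tabulate λ y → does ((x ≟ y) ⊎-dec adj? G x y)

  IsIDCode : Subset n → Set
  IsIDCode C = (∀ x → Nonempty (N[ x ] ∩ C))
             × (∀ x y → x ≢ y → N[ x ] ∩ C ≢ N[ y ] ∩ C)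

  -- γ^ID is a relation rather than a function, because a graph with two
  -- vertices having equal closed neighbourhoods has no identifying code.
  IsγID : ℕ → Set
  IsγID k = (∃[ C ] IsIDCode C × ∣ C ∣ ≡ k)
          × (∀ C → IsIDCode C → k ≤ ∣ C ∣)

{-# OPTIONS --safe #-}

-- Double counting. In a graph whose closed neighbourhoods have at most k
-- vertices, give each vertex x the weight ∣N[x] ∩ C∣, plus 1 if N[x] ∩ C is a
-- singleton. As C is a dominating set, every weight is at least 2. Distributing
-- the weights over the codewords, each c ∈ C receives at most ∣N[c]∣ ≤ k from
-- the first part and, as C separates vertices, at most 1 from the second. Hence
-- 2N ≤ (k + 1)∣C∣, and the grid has k = 5. A minimum code exists because the
-- grid, having no isolated vertex in either factor, has no twins.
module Submission where

open import Defs
open import Data.Nat.Base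
  using (ℕ; zero; suc; _+_; _≤_; _<_; _*_; z≤n; s≤s)
open import Data.Integer.Base using (+_)
open import Data.Rational.Base using (_/_) renaming (_≤_ to _≤ℚ_)
open import Data.Product.Base using (_×_; ∃-syntax)

open import Data.Bool.Base using (if_then_else_; true)
import Data.Bool.Properties as Bool
open import Data.Fin.Base using (Fin; zero; suc; toℕ; inject₁; remQuot; combine)
open import Data.Fin.Properties
  using (_≟_; any?; all?; suc-injective; toℕ-injective; toℕ-inject₁; combine-remQuot; remQuot-combine)
open import Data.Fin.Subset
  using (Subset; Nonempty; _∩_; _∈_; _⊂_; ∣_∣; ⁅_⁆; ⊤; inside; outside)
open import Data.Fin.Subset.Properties
  using (_∈?_; nonempty?; anySubset?; x∈⁅x⁆; x∈⁅y⁆⇒x≡y; ∣⁅x⁆∣≡1; ⊆-antisym;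
         p⊂q⇒∣p∣<∣q∣; x∈p∩q⁺; x∈p∩q⁻; ∈⊤; ∩-identityʳ)
import Data.Integer.Base as ℤ
import Data.Integer.Properties as ℤ
open import Data.Nat.Induction using (Acc; acc; <-wellFounded)
import Data.Nat.Properties as ℕ
open import Data.Product.Base using (∃; _,_; proj₁; proj₂)
open import Data.Product.Properties using (,-injectiveˡ; ,-injectiveʳ)
import Data.Rational.Properties as ℚ
import Data.Rational.Unnormalised.Base as ℚᵘ
import Data.Rational.Unnormalised.Properties as ℚᵘ
open import Data.Sum.Base using (_⊎_; inj₁; inj₂; [_,_])
open import Data.Vec.Base using ([]; _∷_)
open import Data.Vec.Properties using (≡-dec; lookup∘tabulate; []=⇒lookup; lookup⇒[]=)
open import Function.Base using (_∘_)
open import Relation.Binary.Definitions using (DecidableEquality)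
open import Relation.Binary.PropositionalEquality
  using (_≡_; refl; sym; trans; cong; cong₂; subst; subst₂)
open import Relation.Nullary.Decidable
  using (Dec; yes; no; does; ¬?; dec-true; _×-dec_; _⊎-dec_; _→-dec_)
open import Relation.Nullary.Negation using (¬_; contradiction)
open import Relation.Unary using (Pred; Decidable)
open import Level using (0ℓ)
open import Algebra.Properties.CommutativeMonoid.Sum ℕ.+-0-commutativeMonoid
  using (sum; sum-syntax; sum-cong-≗; ∑-distrib-+; ∑-comm)

open Graph

private
  variable
    m n : ℕ
    A B : Set
    U V : Pred (Fin n) 0ℓ

-- Finite sums and counting of decidable predicates.

∑-mono : {f g : Fin n → ℕ} → (∀ i → f i ≤ g i) → sum f ≤ sum g
∑-mono {zero}  f≤g = z≤n
∑-mono {suc n} f≤g = ℕ.+-mono-≤ (f≤g zero) (∑-mono (f≤g ∘ suc))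

∑-const : ∀ n k → ∑[ i < n ] k ≡ n * k
∑-const zero    k = refl
∑-const (suc n) k = cong₂ _+_ (refl {x = k}) (∑-const n k)

∑-*ˡ : ∀ k (f : Fin n → ℕ) → ∑[ i < n ] (k * f i) ≡ k * sum f
∑-*ˡ {zero}  k f = sym (ℕ.*-zeroʳ k)
∑-*ˡ {suc n} k f = trans (cong₂ _+_ (refl {x = k * f zero}) (∑-*ˡ k (f ∘ suc))) (sym (ℕ.*-distribˡ-+ k (f zero) _))

-- Only `does` is inspected, so the indicator reduces on combined or transported decisions whatever
-- their proofs are.
ι : Dec A → ℕ
ι a? = if does a? then 1 else 0

# : Decidable {A = Fin n} U → ℕ
# {n} U? = ∑[ i < n ] ι (U? i)

ι-mono : (a? : Dec A) (b? : Dec B) → (A → B) → ι a? ≤ ι b?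
ι-mono (no _)  b?       f = z≤n
ι-mono (yes a) (yes _)  f = ℕ.≤-refl
ι-mono (yes a) (no ¬b)  f = contradiction (f a) ¬b

ι-⊎ : (a? : Dec A) (b? : Dec B) → ι (a? ⊎-dec b?) ≤ ι a? + ι b?
ι-⊎ (yes _) b? = s≤s z≤n
ι-⊎ (no _)  b? = ℕ.≤-refl

#-mono : (U? : Decidable U) (V? : Decidable V) → (∀ i → U i → V i) → # U? ≤ # V?
#-mono U? V? P⊆V = ∑-mono λ i → ι-mono (U? i) (V? i) (P⊆V i)

#-⊎ : (U? : Decidable U) (V? : Decidable V) →
      # (λ i → U? i ⊎-dec V? i) ≤ # U? + # V?
#-⊎ U? V? = ℕ.≤-trans (∑-mono λ i → ι-⊎ (U? i) (V? i))
                      (ℕ.≤-reflexive (∑-distrib-+ (ι ∘ U?) (ι ∘ V?)))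

#-none : (U? : Decidable U) → (∀ i → ¬ U i) → # U? ≡ 0
#-none {zero}  U? ¬U = refl
#-none {suc n} U? ¬U with U? zero
... | yes p = contradiction p (¬U zero)
... | no _  = #-none (U? ∘ suc) (¬U ∘ suc)

#≤1 : (U? : Decidable U) → (∀ i j → U i → U j → i ≡ j) → # U? ≤ 1
#≤1 {zero}  U? uniq = z≤n
#≤1 {suc n} U? uniq with U? zero
... | yes p = s≤s (ℕ.≤-reflexive (#-none (U? ∘ suc) λ i q → contradiction (uniq zero (suc i) p q) λ ()))
... | no _  = #≤1 (U? ∘ suc) λ i j p q → suc-injective (uniq (suc i) (suc j) p q)

-- Bounds one column of a double count: nothing is counted if `B` fails, and at most one index
-- otherwise. It serves both for the fibres of an injection and for the vertices whose trace on a
-- code is a given singleton.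
#≤ι : (U? : Decidable U) (b? : Dec B) → (∀ i → U i → B) →
      (∀ i j → U i → U j → i ≡ j) → # U? ≤ ι b?
#≤ι U? (yes _) U⇒B uniq = #≤1 U? uniq
#≤ι U? (no ¬b) U⇒B uniq = ℕ.≤-reflexive (#-none U? λ i → ¬b ∘ U⇒B i)

1≤# : (U? : Decidable U) → ∀ i → U i → 1 ≤ # U?
1≤# U? zero    p = subst (λ b → 1 ≤ (if b then 1 else 0) + # (U? ∘ suc)) (sym (dec-true (U? zero) p)) (s≤s z≤n)
1≤# U? (suc i) p = ℕ.≤-trans (1≤# (U? ∘ suc) i p) (ℕ.m≤n+m _ (ι (U? zero)))

#-injection : {U : Pred (Fin m) 0ℓ} {V : Pred (Fin n) 0ℓ}
              (U? : Decidable U) (V? : Decidable V) (f : Fin m → Fin n) →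
              (∀ i → U i → V (f i)) →
              (∀ i j → U i → U j → f i ≡ f j → i ≡ j) →
              # U? ≤ # V?
#-injection {m} {n} U? V? f P⇒V inj = begin
  -- Double counting of the pairs `(i , f i)` with `U i`: each such row holds at least one pair; a
  -- column `j` holds at most one by injectivity, and none unless `V j`.
  # U?                                                     ≤⟨ ∑-mono count-image ⟩
  ∑[ i < m ] ∑[ j < n ] ι (U? i ×-dec (f i ≟ j))           ≡⟨ ∑-comm (λ i j → ι (U? i ×-dec (f i ≟ j))) ⟩
  ∑[ j < n ] ∑[ i < m ] ι (U? i ×-dec (f i ≟ j))           ≤⟨ ∑-mono count-fibre ⟩
  # V?                                                     ∎
  where
  open ℕ.≤-Reasoning
  count-image : ∀ i → ι (U? i) ≤ # (λ j → U? i ×-dec (f i ≟ j))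
  count-image i with U? i
  ... | yes p = 1≤# (λ j → yes p ×-dec (f i ≟ j)) (f i) (p , refl)
  ... | no _  = z≤n
  count-fibre : ∀ j → # (λ i → U? i ×-dec (f i ≟ j)) ≤ ι (V? j)
  count-fibre j = #≤ι (λ i → U? i ×-dec (f i ≟ j)) (V? j)
    (λ { i (p , refl) → P⇒V i p })
    (λ { i k (p , e) (q , e′) → inj i k p q (trans e (sym e′)) })

-- Cardinality of subsets.

∣p∣≡# : (p : Subset n) → ∣ p ∣ ≡ # (_∈? p)
∣p∣≡# []            = refl
∣p∣≡# (inside  ∷ p) = cong suc (∣p∣≡# p)
∣p∣≡# (outside ∷ p) = ∣p∣≡# p

_≟ˢ_ : DecidableEquality (Subset n)
_≟ˢ_ = ≡-dec Bool._≟_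

-- An element other than `c` makes `∣ p ∣` at least 2 on its own; without one, `p` is `⁅ c ⁆` and
-- each summand supplies 1.
2≤∣p∣+#singletons : {p : Subset n} → Nonempty p →
                    2 ≤ ∣ p ∣ + # (λ c → p ≟ˢ ⁅ c ⁆)
2≤∣p∣+#singletons {p = p} (c , c∈p) with any? (λ d → (d ∈? p) ×-dec ¬? (d ≟ c))
... | yes (d , d∈p , d≢c) = ℕ.m≤n⇒m≤n+o _
  (subst (_< ∣ p ∣) (∣⁅x⁆∣≡1 c) (p⊂q⇒∣p∣<∣q∣ ⁅c⁆⊂p))
  where
  ⁅c⁆⊂p : ⁅ c ⁆ ⊂ p
  ⁅c⁆⊂p = (λ x∈⁅c⁆ → subst (_∈ p) (sym (x∈⁅y⁆⇒x≡y _ x∈⁅c⁆)) c∈p)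
        , d , d∈p , d≢c ∘ x∈⁅y⁆⇒x≡y _
... | no ∄d = ℕ.+-mono-≤
  (subst (1 ≤_) (sym (trans (cong ∣_∣ p≡⁅c⁆) (∣⁅x⁆∣≡1 c))) ℕ.≤-refl)
  (1≤# (λ c → p ≟ˢ ⁅ c ⁆) c p≡⁅c⁆)
  where
  only-c : ∀ {d} → d ∈ p → d ∈ ⁅ c ⁆
  only-c {d} d∈p with d ≟ c
  ... | yes refl = x∈⁅x⁆ c
  ... | no d≢c   = contradiction (d , d∈p , d≢c) ∄d
  p≡⁅c⁆ : p ≡ ⁅ c ⁆
  p≡⁅c⁆ = ⊆-antisym only-c λ x∈⁅c⁆ → subst (_∈ p) (sym (x∈⁅y⁆⇒x≡y _ x∈⁅c⁆)) c∈p

-- Closed neighbourhoods and identifying codes in an arbitrary graph.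

module _ (G : Graph n) where

  ∈N⇒ : ∀ {x y} → y ∈ N[_] G x → x ≡ y ⊎ Adj G x y
  ∈N⇒ {x} {y} y∈N = lemma ((x ≟ y) ⊎-dec adj? G x y)
    (trans (sym (lookup∘tabulate (λ z → does ((x ≟ z) ⊎-dec adj? G x z)) y)) ([]=⇒lookup y∈N))
    where
    lemma : (a? : Dec A) → does a? ≡ true → A
    lemma (yes a) _ = a

  ∈N⇐ : ∀ {x y} → x ≡ y ⊎ Adj G x y → y ∈ N[_] G x
  ∈N⇐ {x} {y} a = lookup⇒[]= y _
    (trans (lookup∘tabulate (λ z → does ((x ≟ z) ⊎-dec adj? G x z)) y)
           (dec-true ((x ≟ y) ⊎-dec adj? G x y) a))

  x∈N[x] : ∀ x → x ∈ N[_] G x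
  x∈N[x] x = ∈N⇐ (inj₁ refl)

  ∈N-sym : ∀ {x y} → y ∈ N[_] G x → x ∈ N[_] G y
  ∈N-sym = ∈N⇐ ∘ [ inj₁ ∘ sym , inj₂ ∘ adj-sym G ] ∘ ∈N⇒

  deg : Fin n → ℕ
  deg x = # (adj? G x)

  ∣N∣≤1+deg : ∀ x → ∣ N[_] G x ∣ ≤ suc (deg x)
  ∣N∣≤1+deg x = begin
    ∣ N[_] G x ∣                          ≡⟨ ∣p∣≡# (N[_] G x) ⟩
    # (_∈? N[_] G x)                      ≤⟨ #-mono (_∈? N[_] G x) (λ y → (x ≟ y) ⊎-dec adj? G x y) (λ _ → ∈N⇒) ⟩
    # (λ y → (x ≟ y) ⊎-dec adj? G x y)    ≤⟨ #-⊎ (x ≟_) (adj? G x) ⟩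
    # (x ≟_) + deg x                      ≤⟨ ℕ.+-monoˡ-≤ (deg x) (#≤1 (x ≟_) λ _ _ e e′ → trans (sym e) e′) ⟩
    suc (deg x)                           ∎
    where open ℕ.≤-Reasoning

  isIDCode? : Decidable (IsIDCode G)
  isIDCode? C =
    all? (λ x → nonempty? (N[_] G x ∩ C)) ×-dec
    all? (λ x → all? λ y → ¬? (x ≟ y) →-dec ¬? ((N[_] G x ∩ C) ≟ˢ (N[_] G y ∩ C)))

  -- Well-founded descent on cardinality: being a code is decidable, so all subsets can be searched
  -- for a strictly smaller code. When the search fails, the current code is minimum.
  IDCode⇒γID : ∀ {C} → IsIDCode G C → ∃ (IsγID G)
  IDCode⇒γID {C} code = go C code (<-wellFounded ∣ C ∣)
    where
    go : ∀ C → IsIDCode G C → Acc _<_ ∣ C ∣ → ∃ (IsγID G)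
    go C code (acc smaller) with anySubset? (λ D → isIDCode? D ×-dec (∣ D ∣ ℕ.<? ∣ C ∣))
    ... | yes (D , code′ , D<C) = go D code′ (smaller D<C)
    ... | no ∄D = ∣ C ∣ , (C , code , refl) , λ D code′ → ℕ.≮⇒≥ λ D<C → ∄D (D , code′ , D<C)

  TwinFree : Set
  TwinFree = ∀ x y → N[_] G x ≡ N[_] G y → x ≡ y

  -- Intersecting with `⊤` changes nothing, so separation by all vertices is exactly the absence of
  -- twins; each vertex dominates itself.
  twinFree⇒IDCode : TwinFree → IsIDCode G ⊤
  twinFree⇒IDCode tf =
    (λ x → x , x∈p∩q⁺ (x∈N[x] x , ∈⊤)) ,
    (λ x y x≢y e → x≢y (tf x y (trans (sym (∩-identityʳ _)) (trans e (∩-identityʳ _)))))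

  IDCode-bound : ∀ {k C} → (∀ x → ∣ N[_] G x ∣ ≤ k) → IsIDCode G C → n * 2 ≤ suc k * ∣ C ∣
  IDCode-bound {k} {C} N≤k (dominating , separating) = begin
    n * 2                                                                  ≡⟨ ∑-const n 2 ⟨
    ∑[ x < n ] 2                                                           ≤⟨ ∑-mono (λ x → 2≤∣p∣+#singletons (dominating x)) ⟩
    ∑[ x < n ] (∣ S x ∣ + # (isSing? x))                                   ≡⟨ ∑-distrib-+ (∣_∣ ∘ S) (λ x → # (isSing? x)) ⟩
    ∑[ x < n ] ∣ S x ∣ + ∑[ x < n ] # (isSing? x)                          ≡⟨ cong (_+ ∑[ x < n ] # (isSing? x)) (sum-cong-≗ (∣p∣≡# ∘ S)) ⟩
    -- Exchanging the order of summation regroups the weights by the vertex `c` that receives them.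
    ∑[ x < n ] # (_∈? S x) + ∑[ x < n ] # (isSing? x)                      ≡⟨ cong₂ _+_ (∑-comm λ x c → ι (c ∈? S x)) (∑-comm λ x c → ι (isSing? x c)) ⟩
    ∑[ c < n ] # (λ x → c ∈? S x) + ∑[ c < n ] # (λ x → isSing? x c)       ≤⟨ ℕ.+-mono-≤ (∑-mono members) (∑-mono singletons) ⟩
    ∑[ c < n ] (k * ι (c ∈? C)) + # (_∈? C)                                ≡⟨ cong (_+ # (_∈? C)) (∑-*ˡ k (λ c → ι (c ∈? C))) ⟩
    k * # (_∈? C) + # (_∈? C)                                              ≡⟨ ℕ.+-comm _ (# (_∈? C)) ⟩
    suc k * # (_∈? C)                                                      ≡⟨ cong (suc k *_) (∣p∣≡# C) ⟨
    suc k * ∣ C ∣                                                          ∎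
    where
    open ℕ.≤-Reasoning
    S : Fin n → Subset n
    S x = N[_] G x ∩ C
    isSing? : ∀ x c → Dec (S x ≡ ⁅ c ⁆)
    isSing? x c = S x ≟ˢ ⁅ c ⁆
    -- By symmetry of adjacency, `c ∈ S x` puts `x` in the closed neighbourhood of `c`, of size at
    -- most `k`. A vertex outside `C` lies in no `S x`, whence the factor `ι (c ∈? C)`.
    members : ∀ c → # (λ x → c ∈? S x) ≤ k * ι (c ∈? C)
    members c with c ∈? C
    ... | yes _ = begin
      # (λ x → c ∈? S x)    ≤⟨ #-mono (λ x → c ∈? S x) (_∈? N[_] G c) (λ x → ∈N-sym ∘ proj₁ ∘ x∈p∩q⁻ _ _) ⟩
      # (_∈? N[_] G c)      ≡⟨ ∣p∣≡# (N[_] G c) ⟨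
      ∣ N[_] G c ∣          ≤⟨ N≤k c ⟩
      k                     ≡⟨ ℕ.*-identityʳ k ⟨
      k * 1                 ∎
    ... | no c∉C = ℕ.≤-trans
      (ℕ.≤-reflexive (#-none (λ x → c ∈? S x) (λ x → c∉C ∘ proj₂ ∘ x∈p∩q⁻ (N[_] G x) C))) z≤n
    -- If `S x` is `⁅ c ⁆` then `c` is a codeword, and separation allows only one such `x`.
    singletons : ∀ c → # (λ x → isSing? x c) ≤ ι (c ∈? C)
    singletons c = #≤ι (λ x → isSing? x c) (c ∈? C)
      (λ x e → proj₂ (x∈p∩q⁻ (N[_] G x) C (subst (c ∈_) (sym e) (x∈⁅x⁆ c))))
      same
      where
      same : ∀ x y → S x ≡ ⁅ c ⁆ → S y ≡ ⁅ c ⁆ → x ≡ y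
      same x y e e′ with x ≟ y
      ... | yes x≡y = x≡y
      ... | no x≢y  = contradiction (trans e (sym e′)) (separating x y x≢y)

-- Paths.

deg-P≤2 : ∀ n i → deg (P n) i ≤ 2
deg-P≤2 n i = ℕ.≤-trans (#-⊎ next? prev?) (ℕ.+-mono-≤
  (#≤1 next? λ _ _ e e′ → toℕ-injective (trans (sym e) e′))
  (#≤1 prev? λ _ _ e e′ → toℕ-injective (ℕ.suc-injective (trans e (sym e′)))))
  where
  next? = λ (j : Fin n) → suc (toℕ i) ℕ.≟ toℕ j
  prev? = λ (j : Fin n) → suc (toℕ j) ℕ.≟ toℕ i

NoIsolated : Graph n → Set
NoIsolated {n} G = ∀ x → ∃[ y ] Adj G x y

-- The first vertex steps forward, which takes a second vertex; every other one steps back.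
P-noIsolated : 2 ≤ n → NoIsolated (P n)
P-noIsolated (s≤s (s≤s _)) zero    = suc zero , inj₁ refl
P-noIsolated (s≤s (s≤s _)) (suc i) = inject₁ i , inj₂ (cong suc (toℕ-inject₁ i))

-- Degrees and twins in Cartesian products.

module _ (G : Graph m) (H : Graph n) where

  private
    rq : Fin (m * n) → Fin m × Fin n
    rq = remQuot {m} n

    rq-injective : ∀ {x y} → rq x ≡ rq y → x ≡ y
    rq-injective {x} {y} e = trans (sym (combine-remQuot {m} n x))
      (trans (cong (λ (u , v) → combine u v) e) (combine-remQuot {m} n y))

  -- Neighbours of `x` that share one coordinate with it are determined by the other, so projection
  -- embeds each of the two kinds into the neighbours in one factor.
  deg-□ : ∀ x → deg (G □ H) x ≤ deg H (proj₂ (rq x)) + deg G (proj₁ (rq x))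
  deg-□ x = ℕ.≤-trans (#-⊎ horizontal? vertical?) (ℕ.+-mono-≤
    (#-injection horizontal? (adj? H v) (proj₂ ∘ rq) (λ _ → proj₂)
      λ { _ _ (e , _) (e′ , _) f → rq-injective (cong₂ _,_ (trans (sym e) e′) f) })
    (#-injection vertical? (adj? G u) (proj₁ ∘ rq) (λ _ → proj₁)
      λ { _ _ (_ , e) (_ , e′) f → rq-injective (cong₂ _,_ f (trans (sym e) e′)) }))
    where
    u = proj₁ (rq x)
    v = proj₂ (rq x)
    horizontal? = λ y → (u ≟ proj₁ (rq y)) ×-dec adj? H v (proj₂ (rq y))
    vertical?   = λ y → adj? G u (proj₁ (rq y)) ×-dec (v ≟ proj₂ (rq y))

  -- If (u , v) and (u , v′) are adjacent and u′ is a neighbour of u, then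
  -- (u′ , v) is a neighbour of the former but not of the latter.
  □-twinFree : NoIsolated G → NoIsolated H → TwinFree (G □ H)
  -- Since `y` lies in its own closed neighbourhood, twins are equal or adjacent; the adjacent case
  -- is refuted.
  □-twinFree isoG isoH x y N≡ with ∈N⇒ (G □ H) (subst (y ∈_) (sym N≡) (x∈N[x] (G □ H) y))
  ... | inj₁ x≡y = x≡y
  ... | inj₂ x~y = contradiction x~y (separated (rq x) (rq y) step)
    where
    Near : Fin m × Fin n → Fin m × Fin n → Set
    Near p q = p ≡ q ⊎ BoxAdj G H p q

    -- Transfers the inclusion between neighbourhoods from encoded vertices to coordinate pairs.
    step : ∀ q → BoxAdj G H (rq x) q → Near (rq y) q
    step (u , v) a = [ (λ e → inj₁ (trans (cong rq e) (remQuot-combine u v)))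
                     , (λ b → inj₂ (subst (BoxAdj G H (rq y)) (remQuot-combine u v) b)) ]
      (∈N⇒ (G □ H) (subst (combine u v ∈_) N≡
        (∈N⇐ (G □ H) (inj₂ (subst (BoxAdj G H (rq x)) (sym (remQuot-combine u v)) a)))))

    -- Stated for arbitrary pairs so that the shared coordinate can be unified by matching on
    -- `refl`.
    separated : ∀ p q → (∀ r → BoxAdj G H p r → Near q r) → ¬ BoxAdj G H p q
    separated (u , v) (u , v′) s (inj₁ (refl , v~v′))
      with u′ , u~u′ ← isoG u | s (u′ , v) (inj₂ (u~u′ , refl))
    -- Each way for `(u′ , v)` to be near `(u , v′)` forces `u ≡ u′` or `v ≡ v′`, against
    -- irreflexivity.
    ... | inj₁ e                = adj-irrefl H (sym (,-injectiveʳ e)) v~v′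
    ... | inj₂ (inj₁ (e , _))   = adj-irrefl G e u~u′
    ... | inj₂ (inj₂ (_ , e))   = adj-irrefl H (sym e) v~v′
    separated (u , v) (u′ , v) s (inj₂ (u~u′ , refl))
      with v′ , v~v′ ← isoH v | s (u , v′) (inj₁ (refl , v~v′))
    ... | inj₁ e                = adj-irrefl G (sym (,-injectiveˡ e)) u~u′
    ... | inj₂ (inj₁ (e , _))   = adj-irrefl G (sym e) u~u′
    ... | inj₂ (inj₂ (_ , e))   = adj-irrefl H e v~v′

∣N∣-grid≤5 : ∀ m n x → ∣ N[_] (P m □ P n) x ∣ ≤ 5
-- Five is the vertex itself plus at most two neighbours along each path.
∣N∣-grid≤5 m n x = ℕ.≤-trans (∣N∣≤1+deg (P m □ P n) x) (s≤s
  (ℕ.≤-trans (deg-□ (P m) (P n) x) (ℕ.+-mono-≤ (deg-P≤2 n _) (deg-P≤2 m _))))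

grid-γID : 2 ≤ m → 2 ≤ n → ∃ (IsγID (P m □ P n))
grid-γID {m} {n} 2≤m 2≤n = IDCode⇒γID (P m □ P n) (twinFree⇒IDCode (P m □ P n)
  (□-twinFree (P m) (P n) (P-noIsolated 2≤m) (P-noIsolated 2≤n)))

-- The operation `_/_` reduces to lowest terms and is stuck on a variable numerator, so the
-- comparison is made by cross-multiplying unnormalised fractions. Since `mkℚᵘ` stores the
-- denominator minus one, 2 and 0 stand for denominators 3 and 1.
/3≤/1 : ∀ a b → a ≤ b * 3 → (+ a) / 3 ≤ℚ (+ b) / 1
/3≤/1 a b a≤3b = ℚ.toℚᵘ-cancel-≤ (begin
  _                    ≃⟨ ℚ.toℚᵘ-fromℚᵘ (ℚᵘ.mkℚᵘ (+ a) 2) ⟩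
  ℚᵘ.mkℚᵘ (+ a) 2      ≤⟨ ℚᵘ.*≤* (subst₂ ℤ._≤_ (ℤ.pos-* a 1) (ℤ.pos-* b 3)
                            (ℤ.+≤+ (subst (_≤ b * 3) (sym (ℕ.*-identityʳ a)) a≤3b))) ⟩
  ℚᵘ.mkℚᵘ (+ b) 0      ≃⟨ ℚ.toℚᵘ-fromℚᵘ (ℚᵘ.mkℚᵘ (+ b) 0) ⟨
  _                    ∎)
  where open ℚᵘ.≤-Reasoning

theorem16 : (m n : ℕ) → 2 ≤ m → m ≤ n →
    ∃[ γ ] (IsγID (P m □ P n) γ × (+ (m * n)) / 3 ≤ℚ (+ γ) / 1)
theorem16 m n 2≤m m≤n
  with γ , isγ@((C , code , refl) , _) ← grid-γID 2≤m (ℕ.≤-trans 2≤m m≤n)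
  -- Neighbourhoods of size at most 5 give the factor 6 in the counting bound; cancelling 2 leaves
  -- the factor 3.
  = γ , isγ , /3≤/1 (m * n) ∣ C ∣ (ℕ.*-cancelʳ-≤ (m * n) (∣ C ∣ * 3) 2 (begin
      m * n * 2        ≤⟨ IDCode-bound (P m □ P n) (∣N∣-grid≤5 m n) code ⟩
      6 * ∣ C ∣        ≡⟨ ℕ.*-comm 6 ∣ C ∣ ⟩
      ∣ C ∣ * 6        ≡⟨ ℕ.*-assoc ∣ C ∣ 3 2 ⟨
      ∣ C ∣ * 3 * 2    ∎))
  where open ℕ.≤-Reasoning
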